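{- Consider the linear tape sequencing problem (LTS) and the policies FIFO, FIFF and SSF. Then: (a) FIFO, FIFF and SSF are $\Omega(n)$-approximations for the LTS; that is, for each of the three policies there are a constant $c>0$ and, for all sufficiently large $n$, an LTS instance with $n$ files (together with a submission order of the requests, in the case of FIFO) on which the sequence $\pi$ produced by the policy satisfies $\sum_{t=1}^n w_{\pi_t}R_t(\pi)\ \ge\ c\,n\,R^*$. (b) FIFF is optimal if all the $n$ files in the tape are requested (i.e. $w_i=1$ for all $i$) and they are of the same size (i.e. $s_1=\dots=s_n$).
   Context: LTS (linear tape sequencing problem). A tape is a set of files $\mathscr F=\{1,\dots,n\}$ stored contiguously, in index order from left to right, on a line. File $i$ has size $s_i$ (a positive integer number of bits), left position $\ell_i$ and right position $r_i=\ell_i+s_i$, with $\ell_1=0$, $\ell_{i+1}=r_i$, and tape length $L=r_n=\sum_i s_i$. Parameters $w_i\in\{0,1\}$ indicate whether file $i$ is requested ($w_i=1$) or not; it is assumed that $w_1=1$. The tape head starts at position $L$. A file is read by moving the head from $\ell_i$ to $r_i$; the head moves at unit speed. A solution is a permutation $\pi=(\pi_1,\dots,\pi_n)$ of $\mathscr F$ (reading order). The response time of the $t$-th file is $$R_t(\pi)=\sum_{t'=1}^{t}\bigl(s_{\pi_{t'-1}}+d_{\pi_{t'-1},\pi_{t'}}\bigr),\qquad d_{i,j}=|\ell_j-r_i|,$$ with the conventions $s_{\pi_0}=0$ and $r_{\pi_0}=L$. The objective value of $\pi$ is $\sum_{t=1}^n w_{\pi_t}R_t(\pi)$, and the LTS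 asks for $R^*=\min_\pi \sum_{t=1}^n w_{\pi_t}R_t(\pi)$. Policies. FIFO (first-in first-out): reads the requested files in the (arbitrary) order in which the requests were submitted; that order is part of the input. FIFF (first-file-first): reads files in ascending order of their indices, $\pi=(1,2,\dots,n)$. SSF (shortest size first): reads files in ascending order of file size. -}

module Defs where

open import Data.Bool.Base using (Bool; true; if_then_else_)
open import Data.Fin.Base as Fin using (Fin; zero; suc; toℕ; inject; inject!; inject₁)
open import Data.Fin.Permutation using (Permutation′; _⟨$⟩ʳ_; _≈_; id)
open import Data.Integer.Base using (+_)
open import Data.List.Base using (List; _++_; tabulate)
open import Data.List.Membership.Propositional using (_∈_)
open import Data.List.Relation.Unary.Unique.Propositional using (Unique)
open import Data.Nat.Base using (ℕ; suc; _+_; _*_; _≤_; _≥_; _>_; ∣_-_∣)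
open import Data.Nat.Properties using (+-0-commutativeMonoid)
open import Data.Product.Base using (∃; ∃-syntax; Σ-syntax; _×_)
open import Data.Rational.Base as ℚ using (ℚ; 0ℚ)
open import Data.Unit.Base using (⊤)
open import Data.Vec.Functional using (Vector)
open import Function.Base using (_∘_)
open import Function.Bundles using (_⇔_)
open import Relation.Binary.PropositionalEquality.Core using (_≡_)

open import Algebra.Properties.CommutativeMonoid.Sum +-0-commutativeMonoid
  using (sum-syntax; sum⁺-syntax)

-- `shift a f` is the sequence a , f 0 , f 1 , … , so that `shift a f t` is the
-- entry of f preceding index t, with a as the conventional entry before the first.
shift : ∀ {A : Set} {n} → A → Vector A n → Vector A n
shift a f zero    = a
shift a f (suc t) = f (inject₁ t)

-- Files are numbered from 0, so file i of the tape is the element i - 1 of Fin n.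
record Instance (n : ℕ) : Set where
  field
    s               : Fin n → ℕ
    s>0             : ∀ i → s i > 0
    requested       : Fin n → Bool
    first-requested : ∃[ i ] toℕ i ≡ 0 × requested i ≡ true

  w : Fin n → ℕ
  w i = if requested i then 1 else 0

  -- The sum of the sizes of the files j < i.
  ℓ : Fin n → ℕ
  ℓ i = ∑[ j < toℕ i ] s (inject {i = i} j)

  r : Fin n → ℕ
  r i = ℓ i + s i

  L : ℕ
  L = ∑[ i < n ] s i

  -- The summand s_{π_{t-1}} + d_{π_{t-1},π_t}, where s_{π_0} = 0 and r_{π_0} = L.
  leg : Permutation′ n → Fin n → ℕ
  leg π t = shift 0 (s ∘ (π ⟨$⟩ʳ_)) t + ∣ ℓ (π ⟨$⟩ʳ t) - shift L (r ∘ (π ⟨$⟩ʳ_)) t ∣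

  -- The sum of the legs t′ ≤ t.  The bounded index t′ ranges over Fin (suc (toℕ t))
  -- and inject! embeds it into Fin n.
  R : Permutation′ n → Fin n → ℕ
  R π t = ∑[ t′ ≤ toℕ t ] leg π (inject! {i = suc t} t′)

  objective : Permutation′ n → ℕ
  objective π = ∑[ t < n ] (w (π ⟨$⟩ʳ t) * R π t)

  IsOptimal : Permutation′ n → Set
  IsOptimal π = ∀ σ → objective π ≤ objective σ

  IsMinValue : ℕ → Set
  IsMinValue v = ∃[ π ] IsOptimal π × objective π ≡ v

open Instance

-- A policy may need data besides the instance.  The output is a relation because
-- a policy need not determine a unique sequence (for example, ties in SSF).
record Policy : Set₁ where
  field
    Input    : ∀ {n} → Instance n → Set
    Produces : ∀ {n} (I : Instance n) → Input I → Permutation′ n → Set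

open Policy public

record SubmissionOrder {n} (I : Instance n) : Set where
  field
    order    : List (Fin n)
    unique   : Unique order
    complete : ∀ i → i ∈ order ⇔ requested I i ≡ true

open SubmissionOrder

-- A solution sequences every file; the files that are not requested come after
-- all the requested ones, where they do not contribute to the objective.
FIFO : Policy
FIFO .Input          = SubmissionOrder
FIFO .Produces I o π = ∃[ rest ] tabulate (π ⟨$⟩ʳ_) ≡ order o ++ rest

FIFF : Policy
FIFF .Input _        = ⊤
FIFF .Produces _ _ π = π ≈ id

SSF : Policy
SSF .Input _        = ⊤
SSF .Produces I _ π = ∀ t u → t Fin.≤ u → s I (π ⟨$⟩ʳ t) ≤ s I (π ⟨$⟩ʳ u)

fromℕ : ℕ → ℚ
fromℕ k = + k ℚ./ 1

-- The bad ratio is attained however the policy breaks ties.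
IsΩ[n]-approximation : Policy → Set
IsΩ[n]-approximation P =
  Σ[ c ∈ ℚ ] c ℚ.> 0ℚ ×
  Σ[ n₀ ∈ ℕ ] (∀ n → n ≥ n₀ →
    Σ[ I ∈ Instance n ] Σ[ x ∈ Input P I ] Σ[ R* ∈ ℕ ]
      IsMinValue I R* ×
      (∃[ π ] Produces P I x π) ×
      (∀ π → Produces P I x π →
        fromℕ (objective I π) ℚ.≥ c ℚ.* fromℕ n ℚ.* fromℕ R*))

{-# OPTIONS --safe #-}

-- Part (a).  On a tape with a file of size 1, then one of size n * n, then n ∸ 2
-- files of size 2, the file of size 1 is first in index, first among the smallest
-- and, for a suitable submission order, first submitted.  All three policies thus
-- begin with a move across the whole tape, so each of the n responses takes at
-- least n * n.  Reading the tape from right to left serves all files but two within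
-- time O(n), for a total of O(n * n).
--
-- Part (b).  Reading a file advances the head by its size c, so the position of the
-- t-th file read is at least L + t c minus the distance travelled between readings.
-- Hence R_t ≥ L + 2 t c - ℓ_{π_t}, with equality for FIFF, and the sum over t of
-- the right-hand side does not depend on π.

module Submission where

open import Defs
open import Data.Nat.Base using (ℕ)
open import Data.Fin.Permutation using (Permutation′)
open import Data.Product.Base using (_×_)
open import Relation.Binary.PropositionalEquality.Core using (_≡_)

open import Data.Bool.Base using (true)
open import Data.Fin.Base as Fin
  using (Fin; zero; suc; toℕ; inject; inject!; inject₁; opposite)
open import Data.Fin.Induction using (<-weakInduction)
open import Data.Fin.Permutation as Perm using (_⟨$⟩ʳ_; _⟨$⟩ˡ_; _≈_)
open import Data.Fin.Properties using (_≟_; ≤fromℕ; opposite-involutive)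
import Data.Fin.Properties as Fin
import Data.Integer.Base as ℤ
import Data.Integer.Properties as ℤ
open import Data.List.Base using (allFin; [])
open import Data.List.Extrema.Nat using (argmin; f[argmin]≤f[xs])
open import Data.List.Membership.Propositional.Properties using (∈-allFin)
open import Data.List.Properties using (++-identityʳ; ∷-injectiveˡ)
import Data.List.Relation.Unary.All as All
open import Data.List.Relation.Unary.Unique.Propositional.Properties using (allFin⁺)
open import Data.Nat.Base using (zero; suc; _+_; _*_; _≤_; _≥_; z≤n; s≤s; ∣_-_∣)
open import Data.Nat.Properties hiding (_≟_)
open import Data.Nat.Tactic.RingSolver using (solve-∀)
open import Data.Product.Base using (∃-syntax; Σ-syntax; _,_; proj₁; proj₂)
open import Data.Rational.Base as ℚ using (toℚᵘ)
import Data.Rational.Properties as ℚ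
open import Data.Rational.Unnormalised.Base as ℚᵘ using (mkℚᵘ; *≤*)
import Data.Rational.Unnormalised.Properties as ℚᵘ
open import Data.Sum.Base using (_⊎_; inj₁; inj₂)
open import Data.Unit.Base using (tt)
open import Data.Vec.Functional using (Vector)
open import Function.Base using (_∘_)
open import Function.Bundles using (mk⇔)
open import Relation.Binary.PropositionalEquality
  using (refl; sym; trans; cong; cong₂; subst₂; _≢_; _≗_; module ≡-Reasoning)
open import Relation.Nullary using (yes; no; contradiction)

open import Algebra.Properties.CommutativeMonoid.Sum +-0-commutativeMonoid
  using (sum; sum-syntax; sum⁺-syntax; sum-cong-≗; sum-permute; ∑-distrib-+)

open Instance

-- Finite sums

sum-mono-≤ : ∀ {n} {f g : Vector ℕ n} → (∀ i → f i ≤ g i) → sum f ≤ sum g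
sum-mono-≤ {zero}  f≤g = z≤n
sum-mono-≤ {suc n} f≤g = +-mono-≤ (f≤g zero) (sum-mono-≤ (f≤g ∘ suc))

sum≤n*c : ∀ {n c} {f : Vector ℕ n} → (∀ i → f i ≤ c) → sum f ≤ n * c
sum≤n*c {zero}  f≤c = z≤n
sum≤n*c {suc n} f≤c = +-mono-≤ (f≤c zero) (sum≤n*c (f≤c ∘ suc))

n*c≤sum : ∀ {n c} {f : Vector ℕ n} → (∀ i → c ≤ f i) → n * c ≤ sum f
n*c≤sum {zero}  c≤f = z≤n
n*c≤sum {suc n} c≤f = +-mono-≤ (c≤f zero) (n*c≤sum (c≤f ∘ suc))

-- With `f` the file sizes this becomes ℓ_{i+1} = r_i. The predecessor of `suc i` is written
-- `inject₁ i` to fit `<-weakInduction`.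
sum-inject-suc : ∀ {n} (f : Vector ℕ (suc n)) i →
  ∑[ j < toℕ (suc i) ] f (inject {i = suc i} j) ≡
  ∑[ j < toℕ (inject₁ i) ] f (inject {i = inject₁ i} j) + f (inject₁ i)
sum-inject-suc f zero    = +-comm (f zero) 0
sum-inject-suc f (suc i) =
  trans (cong (f zero +_) (sum-inject-suc (f ∘ suc) i)) (sym (+-assoc (f zero) _ _))

sum-inject-fromℕ : ∀ {n} (f : Vector ℕ (suc n)) →
  ∑[ j < toℕ (Fin.fromℕ n) ] f (inject {i = Fin.fromℕ n} j) + f (Fin.fromℕ n) ≡ sum f
sum-inject-fromℕ {zero}  f = +-comm 0 (f zero)
sum-inject-fromℕ {suc n} f =
  trans (+-assoc (f zero) _ _) (cong (f zero +_) (sum-inject-fromℕ (f ∘ suc)))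

sum-inject!-suc : ∀ {n} (f : Vector ℕ (suc n)) i →
  ∑[ j ≤ toℕ (suc i) ] f (inject! {i = suc (suc i)} j) ≡
  ∑[ j ≤ toℕ (inject₁ i) ] f (inject! {i = suc (inject₁ i)} j) + f (suc i)
sum-inject!-suc {suc n} f zero    = identity (f zero) (f (suc zero))
  where
  identity : ∀ a b → a + (b + 0) ≡ a + 0 + b
  identity = solve-∀
sum-inject!-suc {suc n} f (suc i) =
  trans (cong (f zero +_) (sum-inject!-suc (f ∘ suc) i)) (sym (+-assoc (f zero) _ _))

-- Minimisation over permutations

Fin-argmin : ∀ {n} (f : Fin (suc n) → ℕ) → ∃[ i ] (∀ j → f i ≤ f j)
Fin-argmin f = argmin f zero (allFin _) ,
  λ j → All.lookup (f[argmin]≤f[xs] {f = f} zero (allFin _)) (∈-allFin j)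

-- Induction on `n`: a permutation is determined, up to `≈`, by the image of `zero` and a
-- permutation of the rest. For each image the rest is minimised, then the image. Invariance under
-- `≈` is what lets `insert-remove` recover an arbitrary `σ`.
Permutation-argmin : ∀ {n} (f : Permutation′ n → ℕ) →
  (∀ {π σ} → π ≈ σ → f π ≡ f σ) → ∃[ π ] (∀ σ → f π ≤ f σ)
Permutation-argmin {zero}  f f-cong = Perm.id , λ σ → ≤-reflexive (f-cong {Perm.id} {σ} λ ())
Permutation-argmin {suc n} f f-cong =
  Perm.insert zero (proj₁ first) (best (proj₁ first)) , minimal (proj₁ first) (proj₂ first)
  where
  insert-cong : ∀ i {π σ : Permutation′ n} → π ≈ σ →
    Perm.insert zero i π ≈ Perm.insert zero i σ
  insert-cong i π≈σ zero    = refl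
  insert-cong i π≈σ (suc k) = cong (Fin.punchIn i) (π≈σ _)

  f-insert : Fin (suc n) → Permutation′ n → ℕ
  f-insert i π = f (Perm.insert zero i π)

  rest : ∀ i → ∃[ π ] (∀ σ → f-insert i π ≤ f-insert i σ)
  rest i = Permutation-argmin (f-insert i)
    (λ {π} {σ} π≈σ → f-cong (insert-cong i {π} {σ} π≈σ))

  best : Fin (suc n) → Permutation′ n
  best i = proj₁ (rest i)

  first : ∃[ j ] (∀ i → f-insert j (best j) ≤ f-insert i (best i))
  first = Fin-argmin (λ i → f-insert i (best i))

  minimal : ∀ j → (∀ i → f-insert j (best j) ≤ f-insert i (best i)) →
    ∀ σ → f-insert j (best j) ≤ f σ
  minimal j j-least σ = begin
    f-insert j (best j)             ≤⟨ j-least i ⟩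
    f-insert i (best i)             ≤⟨ proj₂ (rest i) (Perm.remove zero σ) ⟩
    f-insert i (Perm.remove zero σ) ≡⟨ f-cong (Perm.insert-remove zero σ) ⟩
    f σ                             ∎
    where
    open ≤-Reasoning
    i = σ ⟨$⟩ʳ zero

-- Response times

shift-cong : ∀ {A : Set} {n} (a : A) {f g : Vector A n} → f ≗ g → shift a f ≗ shift a g
shift-cong a f≗g zero    = refl
shift-cong a f≗g (suc t) = f≗g (inject₁ t)

module _ {n} (I : Instance n) {π σ : Permutation′ n} (π≈σ : π ≈ σ) where

  leg-cong : leg I π ≗ leg I σ
  leg-cong t = cong₂ _+_
    (shift-cong 0 (cong (s I) ∘ π≈σ) t)
    (cong₂ ∣_-_∣ (cong (ℓ I) (π≈σ t)) (shift-cong (L I) (cong (r I) ∘ π≈σ) t))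

  R-cong : R I π ≗ R I σ
  R-cong t = sum-cong-≗ (λ t′ → leg-cong (inject! {i = suc t} t′))

  objective-cong : objective I π ≡ objective I σ
  objective-cong = sum-cong-≗ (λ t → cong₂ _*_ (cong (w I) (π≈σ t)) (R-cong t))

minValue : ∀ {n} (I : Instance n) → ∃[ v ] IsMinValue I v
minValue I with Permutation-argmin (objective I) (λ {π} {σ} → objective-cong I {π} {σ})
... | π , optimal = objective I π , π , optimal , refl

objective≡∑R : ∀ {n} (I : Instance n) → (∀ i → w I i ≡ 1) →
  ∀ π → objective I π ≡ ∑[ t < n ] R I π t
objective≡∑R I w≡1 π =
  sum-cong-≗ (λ t → trans (cong (_* R I π t) (w≡1 (π ⟨$⟩ʳ t))) (*-identityˡ _))

opposite-inject₁ : ∀ {n} (i : Fin n) → opposite (inject₁ i) ≡ suc (opposite i)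
opposite-inject₁ {suc n} zero    = refl
opposite-inject₁ {suc n} (suc i) = cong inject₁ (opposite-inject₁ i)

module _ {m} (I : Instance (suc m)) where

  ℓ-suc : ∀ i → ℓ I (suc i) ≡ r I (inject₁ i)
  ℓ-suc = sum-inject-suc (s I)

  r-last : r I (Fin.fromℕ m) ≡ L I
  r-last = sum-inject-fromℕ (s I)

  R-zero : ∀ π → R I π zero ≡ ∣ ℓ I (π ⟨$⟩ʳ zero) - L I ∣
  R-zero π = +-identityʳ _

  R-suc : ∀ π t → R I π (suc t) ≡ R I π (inject₁ t) + leg I π (suc t)
  R-suc π = sum-inject!-suc (leg I π)

  -- The first leg is a summand of every response time.
  R-zero≤R : ∀ π t → R I π zero ≤ R I π t
  R-zero≤R π t = +-monoʳ-≤ (leg I π zero) z≤n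

  -- After the initial move to the left end, reading in index order leaves the head at the start of
  -- the next file, so only reading time accrues.
  R-id : ∀ t → R I Perm.id t ≡ L I + ℓ I t
  R-id = <-weakInduction _ base step
    where
    open ≡-Reasoning
    base : R I Perm.id zero ≡ L I + 0
    base = trans (R-zero Perm.id) (sym (+-identityʳ (L I)))
    step : ∀ t → R I Perm.id (inject₁ t) ≡ L I + ℓ I (inject₁ t) →
           R I Perm.id (suc t) ≡ L I + ℓ I (suc t)
    step t ih = begin
      R I Perm.id (suc t)
        ≡⟨ R-suc Perm.id t ⟩
      R I Perm.id (inject₁ t) + (s I (inject₁ t) + ∣ ℓ I (suc t) - r I (inject₁ t) ∣)
        ≡⟨ cong₂ (λ ρ d → ρ + (s I (inject₁ t) + d)) ih (m≡n⇒∣m-n∣≡0 (ℓ-suc t)) ⟩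
      L I + ℓ I (inject₁ t) + (s I (inject₁ t) + 0)
        ≡⟨ cong (L I + ℓ I (inject₁ t) +_) (+-identityʳ _) ⟩
      L I + ℓ I (inject₁ t) + s I (inject₁ t)
        ≡⟨ +-assoc (L I) _ _ ⟩
      L I + r I (inject₁ t)
        ≡⟨ cong (L I +_) (ℓ-suc t) ⟨
      L I + ℓ I (suc t) ∎

  -- The leg from a file b to the file a on its left costs 2 s_b + s_a, and
  -- ℓ_b = ℓ_a + s_a, so the left-hand side is invariant along the tape.
  R-reverse : ∀ t → R I Perm.reverse t + (2 * s I (opposite t) + 3 * ℓ I (opposite t)) ≡ 3 * L I
  R-reverse = <-weakInduction _ base step
    where
    open ≡-Reasoning
    base : R I Perm.reverse zero + (2 * s I (Fin.fromℕ m) + 3 * ℓ I (Fin.fromℕ m)) ≡ 3 * L I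
    base = begin
      R I Perm.reverse zero + (2 * a + 3 * x)
        ≡⟨ cong (_+ (2 * a + 3 * x)) (R-zero Perm.reverse) ⟩
      ∣ x - L I ∣ + (2 * a + 3 * x)
        ≡⟨ cong (λ y → ∣ x - y ∣ + (2 * a + 3 * x)) (sym r-last) ⟩
      ∣ x - x + a ∣ + (2 * a + 3 * x)
        ≡⟨ cong (_+ (2 * a + 3 * x)) (∣m-m+n∣≡n x a) ⟩
      a + (2 * a + 3 * x)
        ≡⟨ identity a x ⟩
      3 * (x + a)
        ≡⟨ cong (3 *_) r-last ⟩
      3 * L I ∎
      where
      a = s I (Fin.fromℕ m)
      x = ℓ I (Fin.fromℕ m)
      identity : ∀ a x → a + (2 * a + 3 * x) ≡ 3 * (x + a)
      identity = solve-∀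
    step : ∀ t →
      R I Perm.reverse (inject₁ t) +
        (2 * s I (opposite (inject₁ t)) + 3 * ℓ I (opposite (inject₁ t))) ≡ 3 * L I →
      R I Perm.reverse (suc t) + (2 * s I (opposite (suc t)) + 3 * ℓ I (opposite (suc t))) ≡ 3 * L I
    step t ih rewrite R-suc Perm.reverse t | opposite-inject₁ t | ℓ-suc (opposite t) = begin
      ρ + (b + ∣ x - x + a + b ∣) + (2 * a + 3 * x)
        ≡⟨ cong (λ y → ρ + (b + ∣ x - y ∣) + (2 * a + 3 * x)) (+-assoc x a b) ⟩
      ρ + (b + ∣ x - x + (a + b) ∣) + (2 * a + 3 * x)
        ≡⟨ cong (λ y → ρ + (b + y) + (2 * a + 3 * x)) (∣m-m+n∣≡n x (a + b)) ⟩
      ρ + (b + (a + b)) + (2 * a + 3 * x)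
        ≡⟨ identity ρ a b x ⟩
      ρ + (2 * b + 3 * (x + a))
        ≡⟨ ih ⟩
      3 * L I ∎
      where
      ρ = R I Perm.reverse (inject₁ t)
      a = s I (inject₁ (opposite t))
      b = s I (suc (opposite t))
      x = ℓ I (inject₁ (opposite t))
      identity : ∀ ρ a b x →
        ρ + (b + (a + b)) + (2 * a + 3 * x) ≡ ρ + (2 * b + 3 * (x + a))
      identity = solve-∀

-- Equal sizes

module _ {m} (I : Instance (suc m)) (s-const : ∀ i j → s I i ≡ s I j) where

  -- With equal sizes `ℓ I t` is t c, whichever files `π` has read before. The position of the file
  -- read stands on the right to avoid subtraction.
  L+2ℓ≤R+ℓ : ∀ π t → L I + 2 * ℓ I t ≤ R I π t + ℓ I (π ⟨$⟩ʳ t)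
  L+2ℓ≤R+ℓ π = <-weakInduction _ base step
    where
    open ≤-Reasoning
    base : L I + 0 ≤ R I π zero + ℓ I (π ⟨$⟩ʳ zero)
    base = begin
      L I + 0                           ≡⟨ +-identityʳ (L I) ⟩
      L I                               ≤⟨ m≤n+∣n-m∣ (L I) x ⟩
      x + ∣ x - L I ∣                   ≡⟨ +-comm x _ ⟩
      ∣ x - L I ∣ + x                   ≡⟨ cong (_+ x) (R-zero I π) ⟨
      R I π zero + x                    ∎
      where
      x = ℓ I (π ⟨$⟩ʳ zero)
    step : ∀ t → L I + 2 * ℓ I (inject₁ t) ≤ R I π (inject₁ t) + ℓ I (π ⟨$⟩ʳ inject₁ t) →
           L I + 2 * ℓ I (suc t) ≤ R I π (suc t) + ℓ I (π ⟨$⟩ʳ suc t)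
    step t ih = begin
      L I + 2 * ℓ I (suc t)
        ≡⟨ cong (λ y → L I + 2 * y) (trans (ℓ-suc I t) (cong (z +_) (s-const _ _))) ⟩
      L I + 2 * (z + c)
        ≡⟨ identity₁ (L I) z c ⟩
      L I + 2 * z + 2 * c
        ≤⟨ +-monoˡ-≤ (2 * c) ih ⟩
      ρ + x + 2 * c
        -- One `c` is time spent reading, the other the advance of the head to `x + c`. The triangle
        -- inequality then accounts for the move to `y`.
        ≡⟨ identity₂ ρ x c ⟩
      ρ + c + (x + c)
        ≤⟨ +-monoʳ-≤ (ρ + c) (m≤n+∣n-m∣ (x + c) y) ⟩
      ρ + c + (y + ∣ y - x + c ∣)
        ≡⟨ identity₃ ρ c y _ ⟩
      ρ + (c + ∣ y - x + c ∣) + y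
        ≡⟨ cong (_+ y) (R-suc I π t) ⟨
      R I π (suc t) + y ∎
      where
      c = s I (π ⟨$⟩ʳ inject₁ t)
      x = ℓ I (π ⟨$⟩ʳ inject₁ t)
      y = ℓ I (π ⟨$⟩ʳ suc t)
      z = ℓ I (inject₁ t)
      ρ = R I π (inject₁ t)
      identity₁ : ∀ l z c → l + 2 * (z + c) ≡ l + 2 * z + 2 * c
      identity₁ = solve-∀
      identity₂ : ∀ ρ x c → ρ + x + 2 * c ≡ ρ + c + (x + c)
      identity₂ = solve-∀
      identity₃ : ∀ ρ c y d → ρ + c + (y + d) ≡ ρ + (c + d) + y
      identity₃ = solve-∀

  -- Adding the sum of all left positions to both sides makes the pointwise bound applicable; since
  -- `σ` is a permutation, the same sum cancels at the end.
  ∑R-id≤∑R : ∀ σ → ∑[ t < suc m ] R I Perm.id t ≤ ∑[ t < suc m ] R I σ t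
  ∑R-id≤∑R σ = +-cancelʳ-≤ (sum (ℓ I)) _ _ (begin
    sum (R I Perm.id) + sum (ℓ I)                 ≡⟨ ∑-distrib-+ (R I Perm.id) (ℓ I) ⟨
    ∑[ t < suc m ] (R I Perm.id t + ℓ I t)        ≡⟨ sum-cong-≗ R-id+ℓ ⟩
    ∑[ t < suc m ] (L I + 2 * ℓ I t)              ≤⟨ sum-mono-≤ (L+2ℓ≤R+ℓ σ) ⟩
    ∑[ t < suc m ] (R I σ t + ℓ I (σ ⟨$⟩ʳ t))     ≡⟨ ∑-distrib-+ (R I σ) (ℓ I ∘ (σ ⟨$⟩ʳ_)) ⟩
    sum (R I σ) + ∑[ t < suc m ] ℓ I (σ ⟨$⟩ʳ t)   ≡⟨ cong (sum (R I σ) +_) (sum-permute (ℓ I) σ) ⟨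
    sum (R I σ) + sum (ℓ I)                       ∎)
    where
    open ≤-Reasoning
    identity : ∀ l x → l + x + x ≡ l + 2 * x
    identity = solve-∀
    R-id+ℓ : ∀ t → R I Perm.id t + ℓ I t ≡ L I + 2 * ℓ I t
    R-id+ℓ t = trans (cong (_+ ℓ I t) (R-id I t)) (identity (L I) (ℓ I t))

FIFF-optimal : ∀ n (I : Instance n) → (∀ i → w I i ≡ 1) → (∀ i j → s I i ≡ s I j) →
  ∀ π → π ≈ Perm.id → IsOptimal I π
FIFF-optimal zero    I w≡1 s-const π π≈id σ = z≤n
FIFF-optimal (suc m) I w≡1 s-const π π≈id σ = begin
  objective I π                     ≡⟨ objective-cong I {π} {Perm.id} π≈id ⟩
  objective I Perm.id               ≡⟨ objective≡∑R I w≡1 Perm.id ⟩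
  ∑[ t < suc m ] R I Perm.id t      ≤⟨ ∑R-id≤∑R I s-const σ ⟩
  ∑[ t < suc m ] R I σ t            ≡⟨ objective≡∑R I w≡1 σ ⟨
  objective I σ                     ∎
  where open ≤-Reasoning

-- The bad instances

module _ (k : ℕ) where

  private
    n : ℕ
    n = suc (suc k)

  badSize : Fin n → ℕ
  badSize zero          = 1
  badSize (suc zero)    = n * n
  badSize (suc (suc _)) = 2

  -- File `zero` is thus the unique smallest, so tie-breaking cannot keep SSF from starting with it.
  2≤badSize-suc : ∀ i → 2 ≤ badSize (suc i)
  2≤badSize-suc zero    = s≤s (s≤s z≤n)
  2≤badSize-suc (suc i) = ≤-refl

  badInstance : Instance (suc (suc k))
  badInstance .s               = badSize
  badInstance .s>0 zero        = s≤s z≤n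
  badInstance .s>0 (suc i)     = <⇒≤ (2≤badSize-suc i)
  badInstance .requested _     = true
  badInstance .first-requested = zero , refl , refl

  private
    I = badInstance

  n*n≤L : n * n ≤ L I
  n*n≤L = ≤-trans (m≤m+n (n * n) _) (m≤n+m _ 1)

  L≤1+n*n+k*2 : L I ≤ 1 + (n * n + k * 2)
  L≤1+n*n+k*2 = +-monoʳ-≤ 1 (+-monoʳ-≤ (n * n) (sum≤n*c {k} (λ _ → ≤-refl)))

  L≤n*n+2*n : L I ≤ n * n + 2 * n
  L≤n*n+2*n = begin
    L I                      ≤⟨ L≤1+n*n+k*2 ⟩
    1 + (n * n + k * 2)      ≤⟨ m≤m+n _ 3 ⟩
    1 + (n * n + k * 2) + 3  ≡⟨ identity (n * n) k ⟩
    n * n + 2 * n            ∎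
    where
    open ≤-Reasoning
    identity : ∀ a k → 1 + (a + k * 2) + 3 ≡ a + 2 * suc (suc k)
    identity = solve-∀

  L≤ℓ+2*n : ∀ i → L I ≤ ℓ I (suc (suc i)) + 2 * n
  L≤ℓ+2*n i = begin
    L I                        ≤⟨ L≤n*n+2*n ⟩
    n * n + 2 * n              ≤⟨ +-monoˡ-≤ (2 * n) (≤-trans (m≤m+n (n * n) _) (m≤n+m _ 1)) ⟩
    ℓ I (suc (suc i)) + 2 * n  ∎
    where open ≤-Reasoning

  -- `opposite i` is the time at which the reverse order reads file `i`; this reindexes `R-reverse`
  -- by files and drops the size term.
  R-reverse-opposite : ∀ i → R I Perm.reverse (opposite i) + 3 * ℓ I i ≤ 3 * L I
  R-reverse-opposite i = begin
    ρ + 3 * ℓ I i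
      ≤⟨ +-monoʳ-≤ ρ (m≤n+m _ (2 * s I i)) ⟩
    ρ + (2 * s I i + 3 * ℓ I i)
      ≡⟨ cong (λ j → ρ + (2 * s I j + 3 * ℓ I j)) (opposite-involutive i) ⟨
    ρ + (2 * s I (opposite (opposite i)) + 3 * ℓ I (opposite (opposite i)))
      ≡⟨ R-reverse I (opposite i) ⟩
    3 * L I ∎
    where
    open ≤-Reasoning
    ρ = R I Perm.reverse (opposite i)

  R-reverse≤3*L : ∀ i → R I Perm.reverse (opposite i) ≤ 3 * L I
  R-reverse≤3*L i = ≤-trans (m≤m+n _ (3 * ℓ I i)) (R-reverse-opposite i)

  -- Right of the long file, 3 ℓ cancels all of 3 L except three times the at most 2 n bits from the
  -- file's left end onwards.
  R-reverse≤6*n : ∀ i → R I Perm.reverse (opposite (suc (suc i))) ≤ 6 * n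
  R-reverse≤6*n i = +-cancelʳ-≤ (3 * x) _ _ (begin
    R I Perm.reverse (opposite (suc (suc i))) + 3 * x  ≤⟨ R-reverse-opposite (suc (suc i)) ⟩
    3 * L I                                            ≤⟨ *-monoʳ-≤ 3 (L≤ℓ+2*n i) ⟩
    3 * (x + 2 * n)                                    ≡⟨ identity x n ⟩
    6 * n + 3 * x                                      ∎)
    where
    open ≤-Reasoning
    x = ℓ I (suc (suc i))
    identity : ∀ x n → 3 * (x + 2 * n) ≡ 6 * n + 3 * x
    identity = solve-∀

  objective-reverse≤12*n*n : objective I Perm.reverse ≤ 12 * (n * n)
  objective-reverse≤12*n*n = begin
    objective I Perm.reverse
      ≡⟨ objective≡∑R I (λ _ → refl) Perm.reverse ⟩
    ∑[ t < n ] R I Perm.reverse t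
      ≡⟨ sum-permute (R I Perm.reverse) Perm.reverse ⟩
    ∑[ i < n ] R I Perm.reverse (opposite i)
      -- The two leftmost files cost at most 3 L each, the other `k` at most 6 n each.
      ≤⟨ +-mono-≤ (R-reverse≤3*L zero)
                  (+-mono-≤ (R-reverse≤3*L (suc zero)) (sum≤n*c R-reverse≤6*n)) ⟩
    3 * L I + (3 * L I + k * (6 * n))
      ≤⟨ +-mono-≤ 3*L≤ (+-monoˡ-≤ _ 3*L≤) ⟩
    3 * (n * n + 2 * n) + (3 * (n * n + 2 * n) + k * (6 * n))
      ≡⟨ identity k ⟩
    12 * (n * n) ∎
    where
    open ≤-Reasoning
    3*L≤ : 3 * L I ≤ 3 * (n * n + 2 * n)
    3*L≤ = *-monoʳ-≤ 3 L≤n*n+2*n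
    identity : ∀ k → let n = suc (suc k) in
      3 * (n * n + 2 * n) + (3 * (n * n + 2 * n) + k * (6 * n)) ≡ 12 * (n * n)
    identity = solve-∀

  n*n*n≤objective : ∀ π → π ⟨$⟩ʳ zero ≡ zero → n * (n * n) ≤ objective I π
  n*n*n≤objective π π₀≡0 = begin
    n * (n * n)           ≤⟨ *-monoʳ-≤ n n*n≤L ⟩
    n * L I               ≤⟨ n*c≤sum L≤R ⟩
    ∑[ t < n ] R I π t    ≡⟨ objective≡∑R I (λ _ → refl) π ⟨
    objective I π         ∎
    where
    open ≤-Reasoning
    L≤R : ∀ t → L I ≤ R I π t
    L≤R t = begin
      -- File `zero` starts at 0, so the first move has length `L I`.
      L I                         ≡⟨ cong (λ i → ∣ ℓ I i - L I ∣) π₀≡0 ⟨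
      ∣ ℓ I (π ⟨$⟩ʳ zero) - L I ∣ ≡⟨ R-zero I π ⟨
      R I π zero                  ≤⟨ R-zero≤R I π t ⟩
      R I π t                     ∎

  -- The reverse order bounds the optimum from above. The ratio bound with constant 1/12 is kept
  -- free of division.
  n*R*≤12*objective : ∀ {R*} → IsMinValue I R* → ∀ π → π ⟨$⟩ʳ zero ≡ zero →
    n * R* ≤ 12 * objective I π
  n*R*≤12*objective (ρ , optimal , refl) π π₀≡0 = begin
    n * objective I ρ             ≤⟨ *-monoʳ-≤ n (optimal Perm.reverse) ⟩
    n * objective I Perm.reverse  ≤⟨ *-monoʳ-≤ n objective-reverse≤12*n*n ⟩
    n * (12 * (n * n))            ≡⟨ identity n ⟩
    12 * (n * (n * n))            ≤⟨ *-monoʳ-≤ 12 (n*n*n≤objective π π₀≡0) ⟩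
    12 * objective I π            ∎
    where
    open ≤-Reasoning
    identity : ∀ n → n * (12 * (n * n)) ≡ 12 * (n * (n * n))
    identity = solve-∀

  submissionOrder : SubmissionOrder I
  submissionOrder = record
    { order    = allFin n
    ; unique   = allFin⁺ n
    ; complete = λ i → mk⇔ (λ _ → refl) (λ _ → ∈-allFin i)
    }

  FIFO-reads-zero-first : ∀ π → Produces FIFO I submissionOrder π → π ⟨$⟩ʳ zero ≡ zero
  FIFO-reads-zero-first π (_ , eq) = ∷-injectiveˡ eq

  SSF-reads-zero-first : ∀ π → Produces SSF I tt π → π ⟨$⟩ʳ zero ≡ zero
  SSF-reads-zero-first π sorted = badSize≤1⇒≡0 (begin
    -- `π ⟨$⟩ˡ zero` is the position at which file `zero` is read.
    badSize (π ⟨$⟩ʳ zero)                 ≤⟨ sorted zero (π ⟨$⟩ˡ zero) z≤n ⟩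
    badSize (π ⟨$⟩ʳ (π ⟨$⟩ˡ zero))        ≡⟨ cong badSize (Perm.inverseʳ π) ⟩
    1                                     ∎)
    where
    open ≤-Reasoning
    badSize≤1⇒≡0 : ∀ {i} → badSize i ≤ 1 → i ≡ zero
    badSize≤1⇒≡0 {zero}  _ = refl
    badSize≤1⇒≡0 {suc i} p = contradiction (≤-trans (2≤badSize-suc i) p) λ { (s≤s ()) }

  -- Swapping the long file with the last one gives the sizes 1, 2, ..., 2, n * n.
  SSF-order : Permutation′ n
  SSF-order = Perm.transpose (suc zero) (Fin.fromℕ (suc k))

  SSF-order-size : ∀ t →
    (t ≡ Fin.fromℕ k × badSize (SSF-order ⟨$⟩ʳ suc t) ≡ n * n) ⊎
    (t ≢ Fin.fromℕ k × badSize (SSF-order ⟨$⟩ʳ suc t) ≡ 2)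
  SSF-order-size zero with zero ≟ Fin.fromℕ k
  -- This occurs only for `k` equal to 0, when the long file is already last and the transposition
  -- is trivial.
  ... | yes 0≡k = inj₁ (0≡k , cong (badSize ∘ suc) (sym 0≡k))
  ... | no  0≢k = inj₂ (0≢k , badSize-suc≡2 (Fin.fromℕ k) 0≢k)
    where
    badSize-suc≡2 : ∀ i → zero ≢ i → badSize (suc i) ≡ 2
    badSize-suc≡2 zero    0≢0 = contradiction refl 0≢0
    badSize-suc≡2 (suc i) _   = refl
  SSF-order-size (suc t) with suc t ≟ Fin.fromℕ k
  ... | yes t≡k = inj₁ (t≡k , refl)
  ... | no  t≢k = inj₂ (t≢k , refl)

  SSF-order-sorted : Produces SSF I tt SSF-order
  SSF-order-sorted zero zero _ = ≤-refl
  SSF-order-sorted zero (suc u) _ with SSF-order-size u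
  ... | inj₁ (_ , eq) rewrite eq = s≤s z≤n
  ... | inj₂ (_ , eq) rewrite eq = s≤s z≤n
  SSF-order-sorted (suc t) (suc u) (s≤s t≤u) with SSF-order-size t | SSF-order-size u
  ... | inj₁ (_ , eq) | inj₁ (_ , eq′) rewrite eq | eq′ = ≤-refl
  ... | inj₂ (_ , eq) | inj₁ (_ , eq′) rewrite eq | eq′ = s≤s (s≤s z≤n)
  ... | inj₂ (_ , eq) | inj₂ (_ , eq′) rewrite eq | eq′ = ≤-refl
  -- If `t` is the last position, `t≤u` forces `u` to be last as well.
  ... | inj₁ (refl , _) | inj₂ (u≢k , _) = contradiction (Fin.≤-antisym (≤fromℕ u) t≤u) u≢k

-- Ω(n) bounds

toℚᵘ-fromℕ : ∀ k → toℚᵘ (fromℕ k) ℚᵘ.≃ mkℚᵘ (ℤ.+ k) 0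
toℚᵘ-fromℕ k = ℚ.toℚᵘ-fromℚᵘ (mkℚᵘ (ℤ.+ k) 0)

1/12*-≤ : ∀ n v o → n * v ≤ 12 * o →
  ℤ.+ 1 ℚ./ 12 ℚ.* fromℕ n ℚ.* fromℕ v ℚ.≤ fromℕ o
1/12*-≤ n v o nv≤12o = ℚ.toℚᵘ-cancel-≤ (begin
  toℚᵘ (c ℚ.* fromℕ n ℚ.* fromℕ v)
    ≃⟨ ℚ.toℚᵘ-homo-* (c ℚ.* fromℕ n) (fromℕ v) ⟩
  toℚᵘ (c ℚ.* fromℕ n) ℚᵘ.* toℚᵘ (fromℕ v)
    ≃⟨ ℚᵘ.*-cong (ℚ.toℚᵘ-homo-* c (fromℕ n)) (toℚᵘ-fromℕ v) ⟩
  toℚᵘ c ℚᵘ.* toℚᵘ (fromℕ n) ℚᵘ.* mkℚᵘ (ℤ.+ v) 0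
    ≃⟨ ℚᵘ.*-congʳ {mkℚᵘ (ℤ.+ v) 0} (ℚᵘ.*-congˡ {toℚᵘ c} (toℚᵘ-fromℕ n)) ⟩
  toℚᵘ c ℚᵘ.* mkℚᵘ (ℤ.+ n) 0 ℚᵘ.* mkℚᵘ (ℤ.+ v) 0
    -- For unnormalised rationals the order is cross-multiplication, here with denominators 12 and
    -- 1.
    ≤⟨ *≤* (subst₂ ℤ._≤_ lhs rhs (ℤ.+≤+ nv≤12o)) ⟩
  mkℚᵘ (ℤ.+ o) 0
    ≃⟨ toℚᵘ-fromℕ o ⟨
  toℚᵘ (fromℕ o) ∎)
  where
  open ℚᵘ.≤-Reasoning
  c = ℤ.+ 1 ℚ./ 12
  lhs : ℤ.+ (n * v) ≡ ℤ.+ 1 ℤ.* ℤ.+ n ℤ.* ℤ.+ v ℤ.* ℤ.+ 1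
  lhs = sym (trans (ℤ.*-identityʳ _)
    (trans (cong (ℤ._* ℤ.+ v) (ℤ.*-identityˡ (ℤ.+ n))) (sym (ℤ.pos-* n v))))
  rhs : ℤ.+ (12 * o) ≡ ℤ.+ o ℤ.* ℤ.+ 12
  rhs = trans (cong ℤ.+_ (*-comm 12 o)) (ℤ.pos-* o 12)

-- The ratio is asked for every minimum value `v`, so the optimum of the bad instance need not be
-- computed; `minValue` supplies its existence.
Ω-intro : ∀ P n₀ →
  (∀ n → n ≥ n₀ → Σ[ I ∈ Instance n ] Σ[ x ∈ Input P I ]
    (∃[ π ] Produces P I x π) ×
    (∀ π → Produces P I x π → ∀ v → IsMinValue I v → n * v ≤ 12 * objective I π)) →
  IsΩ[n]-approximation P
Ω-intro P n₀ bad = ℤ.+ 1 ℚ./ 12 , ℚ.positive⁻¹ (ℤ.+ 1 ℚ./ 12) , n₀ , λ n n≥n₀ →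
  let I , x , produced , ratio = bad n n≥n₀
      v , isMin                = minValue I
  in I , x , v , isMin , produced ,
     λ π p → 1/12*-≤ n v (objective I π) (ratio π p v isMin)

Ω-if-zero-read-first : ∀ P →
  (∀ k → Σ[ x ∈ Input P (badInstance k) ]
    (∃[ π ] Produces P (badInstance k) x π) ×
    (∀ π → Produces P (badInstance k) x π → π ⟨$⟩ʳ zero ≡ zero)) →
  IsΩ[n]-approximation P
-- The threshold is 2 because the bad tape always contains the short and the long file.
Ω-if-zero-read-first P reads-zero-first = Ω-intro P 2 λ where
  (suc (suc k)) (s≤s (s≤s z≤n)) →
    let x , produced , zero-first = reads-zero-first k
    in badInstance k , x , produced ,
       λ π p v isMin → n*R*≤12*objective k {v} isMin π (zero-first π p)

proposition2 : (IsΩ[n]-approximation FIFO × IsΩ[n]-approximation FIFF × IsΩ[n]-approximation SSF)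
    × (∀ (n : ℕ) (I : Instance n) →
    (∀ i → Instance.w I i ≡ 1) →
    (∀ i j → Instance.s I i ≡ Instance.s I j) →
    ∀ (x : Input FIFF I) (π : Permutation′ n) →
    Produces FIFF I x π → Instance.IsOptimal I π)
proposition2 =
  ( Ω-if-zero-read-first FIFO (λ k →
      submissionOrder k ,
      (Perm.id , [] , sym (++-identityʳ (allFin (suc (suc k))))) ,
      FIFO-reads-zero-first k)
  , Ω-if-zero-read-first FIFF (λ k → tt , (Perm.id , λ _ → refl) , λ π π≈id → π≈id zero)
  , Ω-if-zero-read-first SSF (λ k → tt , (SSF-order k , SSF-order-sorted k) , SSF-reads-zero-first k)
  ) , λ n I w≡1 s-const _ → FIFF-optimal n I w≡1 s-const
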